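{- There exists an elliptic curve $E$ defined over $\mathbf{Q}$ with $S_y(E) \geq 7$; that is, there exist an elliptic curve $E/\mathbf{Q}$ and seven distinct rational points $P_1,\dots,P_7 \in E(\mathbf{Q})$ whose $y$-coordinates, after a suitable reordering, form an arithmetic progression with nonzero common difference.
   Context: An elliptic curve over $\mathbf{Q}$ is given by a general Weierstrass equation $Y^2 + a_1XY + a_3Y = X^3 + a_2X^2 + a_4X + a_6$ with $a_i \in \mathbf{Q}$ and nonzero discriminant. Rational points $P_0,\dots,P_n \in E$ are said to form a $y$-arithmetic progression if their $y$-coordinates (not necessarily in the order of the indices) form an arithmetic progression with nonzero common difference; $S_y(E)$ denotes the maximal number of rational points of $E$ forming a $y$-arithmetic progression. -}

module Defs where

open import Data.Fin using (Fin; toℕ)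
open import Data.Fin.Permutation using (Permutation′; _⟨$⟩ʳ_)
open import Data.Maybe using (Maybe; just; nothing)
open import Data.Product using (Σ-syntax; ∃-syntax; _×_)
open import Data.Rational using (ℚ; 0ℚ; _+_; _-_; _*_; -_)
open import Data.Rational.Properties using (+-*-rawSemiring)
open import Relation.Binary.PropositionalEquality using (_≡_; _≢_)

-- n · q is the n-fold sum q + … + q, and q ^ n the n-fold product.
open import Algebra.Definitions.RawSemiring +-*-rawSemiring
  using (_^_) renaming (_×_ to _·_)

record WeierstrassCurve : Set where
  field
    a₁ a₂ a₃ a₄ a₆ : ℚ

  OnCurve : ℚ → ℚ → Set
  OnCurve x y =
    y ^ 2 + a₁ * x * y + a₃ * y ≡ x ^ 3 + a₂ * x ^ 2 + a₄ * x + a₆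

  b₂ b₄ b₆ b₈ Δ : ℚ
  b₂ = a₁ ^ 2 + 4 · a₂
  b₄ = 2 · a₄ + a₁ * a₃
  b₆ = a₃ ^ 2 + 4 · a₆
  b₈ = a₁ ^ 2 * a₆ + 4 · (a₂ * a₆) - a₁ * a₃ * a₄ + a₂ * a₃ ^ 2 - a₄ ^ 2
  Δ  = - (b₂ ^ 2 * b₈) - 8 · (b₄ ^ 3) - 27 · (b₆ ^ 2) + 9 · (b₂ * b₄ * b₆)

record EllipticCurve : Set where
  field
    curve : WeierstrassCurve
  open WeierstrassCurve curve public
  field
    Δ≢0 : Δ ≢ 0ℚ

data Point (E : EllipticCurve) : Set where
  𝒪      : Point E
  affine : (x y : ℚ) → EllipticCurve.OnCurve E x y → Point E

-- The point at infinity has no y-coordinate, so it cannot occur in a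
-- y-arithmetic progression.
yCoord : ∀ {E} → Point E → Maybe ℚ
yCoord 𝒪              = nothing
yCoord (affine _ y _) = just y

-- The permutation σ allows the y-coordinates to be in progression in an order
-- other than that of the indices.
IsYArithmeticProgression : ∀ {E n} → (Fin n → Point E) → Set
IsYArithmeticProgression {n = n} P =
  Σ[ σ ∈ Permutation′ n ] ∃[ y₀ ] ∃[ d ] d ≢ 0ℚ ×
    (∀ (i : Fin n) → yCoord (P (σ ⟨$⟩ʳ i)) ≡ just (y₀ + toℕ i · d))

{-# OPTIONS --safe #-}
module Submission where

-- A Weierstrass equation with a free coefficient on y² is linear in its seven
-- coefficients, so seven points (xᵢ , i), −3 ≤ i ≤ 3, lie on such a cubic as
-- soon as one 7 × 7 determinant in the xᵢ vanishes.  It vanishes for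
-- (xᵢ) = (1, 0, −1, 0, −2, −1, −2), where the coefficient of y² is 2; the
-- substitution (x , y) ↦ (2x , 4y) makes the equation monic.

open import Defs
open import Data.Fin using (Fin; toℕ)
open import Data.Fin.Patterns using (0F; 1F; 2F; 3F; 4F; 5F; 6F)
open import Data.Fin.Permutation using () renaming (id to idₚ)
open import Data.Fin.Properties using (all?) renaming (_≟_ to _≟ᶠ_)
open import Data.Integer using (+_; -[1+_])
open import Data.Maybe.Properties using (just-injective)
open import Data.Product using (Σ-syntax; _×_; _,_)
open import Data.Rational using (ℚ; 0ℚ; _+_; _/_; _≟_)
open import Data.Rational.Properties using (+-*-rawSemiring)
open import Function.Definitions using (Injective)
open import Relation.Binary.PropositionalEquality using (_≡_; refl; cong)
open import Relation.Nullary.Decidable using (from-yes; _→-dec_)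

open import Algebra.Definitions.RawSemiring +-*-rawSemiring
  using () renaming (_×_ to _·_)

E : EllipticCurve
E = record
  { curve = record
    { a₁ = + 6 / 1
    ; a₂ = -[1+ 7 ] / 1
    ; a₃ = + 8 / 1
    ; a₄ = -[1+ 35 ] / 1
    ; a₆ = 0ℚ
    }
  -- `Δ` evaluates to -54016 = -2⁸ · 211, so the equation with `0ℚ` is refuted by computation.
  ; Δ≢0 = λ ()
  }

open EllipticCurve E using (OnCurve)

y₀ d : ℚ
y₀ = -[1+ 11 ] / 1
d  = + 4 / 1

x y : Fin 7 → ℚ
x 0F = + 2 / 1
x 1F = 0ℚ
x 2F = -[1+ 1 ] / 1
x 3F = 0ℚ
x 4F = -[1+ 3 ] / 1
x 5F = -[1+ 1 ] / 1
x 6F = -[1+ 3 ] / 1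
y i = y₀ + toℕ i · d

onCurve : ∀ i → OnCurve (x i) (y i)
onCurve 0F = refl
onCurve 1F = refl
onCurve 2F = refl
onCurve 3F = refl
onCurve 4F = refl
onCurve 5F = refl
onCurve 6F = refl

-- The abscissas 0, -2 and -4 each occur twice, so it is the ordinates that tell the points apart;
-- 49 pairs are checked by decision.
y-injective : Injective _≡_ _≡_ y
y-injective {i} {j} =
  from-yes (all? λ i → all? λ j → (y i ≟ y j) →-dec (i ≟ᶠ j)) i j

P : Fin 7 → Point E
P i = affine (x i) (y i) (onCurve i)

P-injective : Injective _≡_ _≡_ P
P-injective Pi≡Pj = y-injective (just-injective (cong yCoord Pi≡Pj))

theorem1 : Σ[ E ∈ EllipticCurve ] Σ[ P ∈ (Fin 7 → Point E) ]
    (Injective _≡_ _≡_ P × IsYArithmeticProgression P)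
-- The indices already follow increasing `y`, so `idₚ` serves; `y` is defined as the progression,
-- whence `refl`.
theorem1 = E , P , P-injective , idₚ , y₀ , d , (λ ()) , λ _ → refl
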